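{- There is an absolute constant $c>0$ such that for every constant $C>0$ there is a constant $K>0$ with the following property. For every integer $n\ge 2$ and every real $\varepsilon$ with $c\,\frac{\log n}{n}\le \varepsilon\le C$, there is a deterministic online algorithm for the online sorting problem that, on every input sequence of $n$ elements of $[0,1]$, inserts all elements into an array with at most $(1+\varepsilon)n$ cells and produces a solution of cost at most $K\,\frac{\log^2 n}{\varepsilon}$.
   Context: Logarithms are base $2$. Online sorting problem: a sequence of $n$ numbers (elements) in $[0,1]$ arrives one at a time, and an array with $m\ge n$ cells is given, where $n$ and $m$ are known in advance. When an element arrives, the algorithm must immediately and irrevocably place it in an empty cell of the array (each cell holds at most one element), without knowledge of future elements. It is assumed that the elements include a pair of sentinel values $0$ and $1$, which are present from the outset and occupy respectively the first and last cells of the array (so the optimal offline cost is $1$). After all elements have been inserted, the cost of the solution is the sum of $|x-y|$ over all pairs $x,y$ of elements occupying consecutive non-empty cells (that is, non-empty cells with no non-empty cell between them). -}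

module Defs where

open import Algebra.Bundles using (CommutativeRing)
open import Algebra.Structures using (IsCommutativeRing)
open import Data.Fin using (Fin)
open import Data.List using (List; []; _∷_; _∷ʳ_; catMaybes)
open import Data.Maybe using (Maybe; just; nothing)
open import Data.Nat as ℕ using (ℕ; zero; suc)
import Data.Nat.Properties as ℕₚ
open import Data.Product using (_×_; _,_; ∃; ∃-syntax; proj₁; proj₂)
open import Data.Sum using (inj₁; inj₂)
open import Data.Vec as Vec using (Vec; lookup; _[_]≔_)
open import Relation.Binary.PropositionalEquality
open import Relation.Binary.Structures using (IsDecTotalOrder)
open import Relation.Nullary using (¬_; yes; no; contradiction)

-- The inverse is total; nothing is assumed about 0# ⁻¹.

record OrderedField : Set₁ where
  infix  4 _≤_ _<_
  infixl 6 _+_ _-_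
  infixl 7 _*_ _/_
  infix  8 -_
  infix  9 _⁻¹
  field
    ℝ       : Set
    _+_ _*_ : ℝ → ℝ → ℝ
    -_ _⁻¹  : ℝ → ℝ
    0# 1#   : ℝ
    _≤_     : ℝ → ℝ → Set

    isCommutativeRing : IsCommutativeRing _≡_ _+_ _*_ -_ 0# 1#
    0≢1               : 0# ≢ 1#
    *-inverseʳ        : ∀ x → x ≢ 0# → x * x ⁻¹ ≡ 1#

    isDecTotalOrder   : IsDecTotalOrder _≡_ _≤_
    +-monoˡ-≤         : ∀ z {x y} → x ≤ y → x + z ≤ y + z
    *-nonNegative     : ∀ {x y} → 0# ≤ x → 0# ≤ y → 0# ≤ x * y

  commutativeRing : CommutativeRing _ _
  commutativeRing = record { isCommutativeRing = isCommutativeRing }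

  open CommutativeRing commutativeRing using (+-rawMonoid)
  open import Algebra.Definitions.RawMonoid +-rawMonoid
    using () renaming (_×_ to _·_)
  open IsDecTotalOrder isDecTotalOrder public
    using (_≤?_; total; antisym)
    renaming (refl to ≤-refl; reflexive to ≤-reflexive; trans to ≤-trans)

  _<_ : ℝ → ℝ → Set
  x < y = x ≤ y × x ≢ y

  _-_ : ℝ → ℝ → ℝ
  x - y = x + - y

  _/_ : ℝ → ℝ → ℝ
  x / y = x * y ⁻¹

  ∣_∣ : ℝ → ℝ
  ∣ x ∣ with 0# ≤? x
  ... | yes _ = x
  ... | no  _ = - x

  fromℕ : ℕ → ℝ
  fromℕ n = n · 1#

  UpperBound : (ℝ → Set) → ℝ → Set
  UpperBound P b = ∀ x → P x → x ≤ b

  Supremum : (ℝ → Set) → ℝ → Set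
  Supremum P s = UpperBound P s × (∀ b → UpperBound P b → s ≤ b)

-- The real numbers, axiomatised as a Dedekind-complete ordered field with
-- decidable order (that is, with the classical order on the reals).
-- The Archimedean property follows classically from completeness; it is a
-- field so that the natural number is available without excluded middle.

record Reals : Set₁ where
  field
    orderedField : OrderedField
  open OrderedField orderedField public
  field
    archimedean : ∀ x → ∃[ n ] x ≤ fromℕ n
    complete    : ∀ P → ∃ P → ∃ (UpperBound P) → ∃ (Supremum P)

module Log₂ (R : Reals) where
  open Reals R
  open CommutativeRing commutativeRing
    using (+-identityˡ; +-identityʳ; +-comm; -‿inverseʳ; *-assoc; *-comm; *-identityˡ;
           *-identityʳ; zeroˡ; zeroʳ; distribʳ; ring; semiring)
  open import Algebra.Properties.Ring ring using (-‿distribʳ-*; -‿distribˡ-*; -‿involutive)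
  open import Algebra.Properties.Semiring.Mult semiring using (×1-homo-*)
  open ≡-Reasoning

  -- The rationals p / q with 2 ^ (p / q) ≤ n and p ≥ 0, q ≥ 1.
  -- Negative p are not needed for a supremum, as p = 0 qualifies when n ≥ 1.
  BelowLog₂ : ℕ → ℝ → Set
  BelowLog₂ n x = ∃[ p ] ∃[ q ] x ≡ fromℕ p / fromℕ (suc q) × 2 ℕ.^ p ℕ.≤ n ℕ.^ suc q

  private
    ≤⇒-≥0 : ∀ {x y} → x ≤ y → 0# ≤ y - x
    ≤⇒-≥0 {x} {y} x≤y = subst (_≤ y - x) (-‿inverseʳ x) (+-monoˡ-≤ (- x) x≤y)

    ≤0⇒-≥0 : ∀ {x} → x ≤ 0# → 0# ≤ - x
    ≤0⇒-≥0 {x} p = subst (0# ≤_) (+-identityˡ (- x)) (≤⇒-≥0 p)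

    -≥0⇒≤ : ∀ {x y} → 0# ≤ y - x → x ≤ y
    -≥0⇒≤ {x} {y} p = subst₂ _≤_ (+-identityˡ x) lemma (+-monoˡ-≤ x p)
      where
      open CommutativeRing commutativeRing using (+-assoc; -‿inverseˡ)
      lemma : y - x + x ≡ y
      lemma = trans (+-assoc y (- x) x) (trans (cong (y +_) (-‿inverseˡ x)) (+-identityʳ y))

    0≤1 : 0# ≤ 1#
    0≤1 with total 0# 1#
    ... | inj₁ p = p
    ... | inj₂ p = subst (0# ≤_) -1*-1≡1 (*-nonNegative (≤0⇒-≥0 p) (≤0⇒-≥0 p))
      where
      -1*-1≡1 : (- 1#) * (- 1#) ≡ 1#
      -1*-1≡1 = begin
        (- 1#) * (- 1#)  ≡⟨ sym (-‿distribʳ-* (- 1#) 1#) ⟩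
        - ((- 1#) * 1#)  ≡⟨ cong -_ (*-identityʳ (- 1#)) ⟩
        - (- 1#)         ≡⟨ -‿involutive 1# ⟩
        1#               ∎

    x≤1+x : ∀ x → x ≤ 1# + x
    x≤1+x x = subst (_≤ 1# + x) (+-identityˡ x) (+-monoˡ-≤ x 0≤1)

    0≤fromℕ : ∀ n → 0# ≤ fromℕ n
    0≤fromℕ zero    = ≤-refl
    0≤fromℕ (suc n) = ≤-trans (0≤fromℕ n) (x≤1+x (fromℕ n))

    fromℕ-mono : ∀ {m n} → m ℕ.≤ n → fromℕ m ≤ fromℕ n
    fromℕ-mono {n = n} ℕ.z≤n = 0≤fromℕ n
    fromℕ-mono {suc m} {suc n} (ℕ.s≤s m≤n) =
      subst₂ _≤_ (+-comm _ 1#) (+-comm _ 1#) (+-monoˡ-≤ 1# (fromℕ-mono m≤n))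

    fromℕ-suc≢0 : ∀ n → fromℕ (suc n) ≢ 0#
    fromℕ-suc≢0 n eq = 0≢1 (antisym 0≤1 1≤0)
      where
      1≤0 : 1# ≤ 0#
      1≤0 = subst₂ _≤_ (+-identityʳ 1#) eq (fromℕ-mono {1} {suc n} (ℕ.s≤s ℕ.z≤n))

    0≤⁻¹ : ∀ {x} → 0# ≤ x → x ≢ 0# → 0# ≤ x ⁻¹
    0≤⁻¹ {x} 0≤x x≢0 with total 0# (x ⁻¹)
    ... | inj₁ p = p
    ... | inj₂ p = contradiction (antisym 0≤1 (-≥0⇒≤ 0≤0-1)) 0≢1
      where
      0≤0-1 : 0# ≤ 0# - 1#
      0≤0-1 = subst (0# ≤_) (begin
        x * (- x ⁻¹)  ≡⟨ sym (-‿distribʳ-* x (x ⁻¹)) ⟩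
        - (x * x ⁻¹)  ≡⟨ cong -_ (*-inverseʳ x x≢0) ⟩
        - 1#          ≡⟨ sym (+-identityˡ (- 1#)) ⟩
        0# - 1#       ∎) (*-nonNegative 0≤x (≤0⇒-≥0 p))

    *-monoˡ-≤ : ∀ {x y z} → 0# ≤ z → x ≤ y → x * z ≤ y * z
    *-monoˡ-≤ {x} {y} {z} 0≤z x≤y = -≥0⇒≤ (subst (0# ≤_)
      (trans (distribʳ z y (- x)) (cong (y * z +_) (sym (-‿distribˡ-* x z))))
      (*-nonNegative (≤⇒-≥0 x≤y) 0≤z))

    n≤2^n : ∀ n → n ℕ.≤ 2 ℕ.^ n
    n≤2^n zero    = ℕ.z≤n
    n≤2^n (suc n) = ℕₚ.+-mono-≤ (ℕₚ.m^n>0 2 n)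
      (ℕₚ.≤-trans (n≤2^n n) (ℕₚ.m≤m+n (2 ℕ.^ n) 0))

    2^-cancel-≤ : ∀ {p r} → 2 ℕ.^ p ℕ.≤ 2 ℕ.^ r → p ℕ.≤ r
    2^-cancel-≤ {p} {r} le with p ℕ.≤? r
    ... | yes p≤r = p≤r
    ... | no  p≰r = contradiction
      (ℕₚ.^-monoʳ-< 2 (ℕ.s≤s (ℕ.s≤s ℕ.z≤n)) (ℕₚ.≰⇒> p≰r)) (ℕₚ.≤⇒≯ le)

    nonempty : ∀ n → ∃ (BelowLog₂ (suc n))
    nonempty n = _ , 0 , 0 , refl , ℕ.s≤s ℕ.z≤n

    bounded : ∀ n → UpperBound (BelowLog₂ n) (fromℕ n)
    bounded n x (p , q , refl , 2^p≤n^q) =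
      subst (fromℕ p / fromℕ (suc q) ≤_) n*q/q≡n
        (*-monoˡ-≤ (0≤⁻¹ (0≤fromℕ (suc q)) (fromℕ-suc≢0 q)) (fromℕ-mono p≤nq))
      where
      p≤nq : p ℕ.≤ n ℕ.* suc q
      p≤nq = 2^-cancel-≤ (ℕₚ.≤-trans 2^p≤n^q
        (ℕₚ.≤-trans (ℕₚ.^-monoˡ-≤ (suc q) (n≤2^n n))
          (ℕₚ.≤-reflexive (ℕₚ.^-*-assoc 2 n (suc q)))))

      n*q/q≡n : fromℕ (n ℕ.* suc q) / fromℕ (suc q) ≡ fromℕ n
      n*q/q≡n = begin
        fromℕ (n ℕ.* suc q) * fromℕ (suc q) ⁻¹
          ≡⟨ cong (_* fromℕ (suc q) ⁻¹) (×1-homo-* n (suc q)) ⟩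
        fromℕ n * fromℕ (suc q) * fromℕ (suc q) ⁻¹
          ≡⟨ *-assoc (fromℕ n) (fromℕ (suc q)) (fromℕ (suc q) ⁻¹) ⟩
        fromℕ n * (fromℕ (suc q) * fromℕ (suc q) ⁻¹)
          ≡⟨ cong (fromℕ n *_) (*-inverseʳ (fromℕ (suc q)) (fromℕ-suc≢0 q)) ⟩
        fromℕ n * 1#
          ≡⟨ *-identityʳ (fromℕ n) ⟩
        fromℕ n ∎

    log₂-sup : ∀ n → ∃ (Supremum (BelowLog₂ (suc n)))
    log₂-sup n = complete (BelowLog₂ (suc n)) (nonempty n) (_ , bounded (suc n))

  -- The base-2 logarithm of a positive natural number, as a Dedekind cut;
  -- the value at 0 is a convention.
  log₂ : ℕ → ℝ
  log₂ zero    = 0#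
  log₂ (suc n) = proj₁ (log₂-sup n)

  log₂-supremum : ∀ n → Supremum (BelowLog₂ (suc n)) (log₂ (suc n))
  log₂-supremum n = proj₂ (log₂-sup n)

module OnlineSorting (R : Reals) where
  open Reals R
  open Log₂ R public using (log₂)

  InUnitInterval : ℝ → Set
  InUnitInterval x = 0# ≤ x × x ≤ 1#

  Array : ℕ → Set
  Array m = Vec (Maybe ℝ) m

  -- The array of 2 + k cells before any arrival: the sentinels 0 and 1
  -- occupy the first and last cells and the other k cells are empty.
  initial : ∀ k → Array (2 ℕ.+ k)
  initial k = just 0# Vec.∷ (Vec.replicate k nothing Vec.∷ʳ just 1#)

  -- A deterministic online algorithm for m cells chooses a cell from the
  -- elements that arrived earlier (in order of arrival, without sentinels)
  -- and the arriving element.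
  OnlineAlgorithm : ℕ → Set
  OnlineAlgorithm m = (past : List ℝ) (current : ℝ) → Fin m

  -- run A past xs a inserts xs into a, the elements of past having been
  -- inserted before. It fails as soon as A chooses an occupied cell.
  run : ∀ {m} → OnlineAlgorithm m → (past xs : List ℝ) → Array m → Maybe (Array m)
  run A past []       a = just a
  run A past (x ∷ xs) a with lookup a (A past x)
  ... | just _  = nothing
  ... | nothing = run A (past ∷ʳ x) xs (a [ A past x ]≔ just x)

  variation : List ℝ → ℝ
  variation (x ∷ y ∷ ys) = ∣ x - y ∣ + variation (y ∷ ys)
  variation _            = 0#

  cost : ∀ {m} → Array m → ℝ
  cost a = variation (catMaybes (Vec.toList a))

{-# OPTIONS --safe #-}

-- Split [0,1] into a dyadic tree of depth D, with nodes of height h at depth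
-- D ∸ h, and let a node of height h receive memory in boxes of 2 ^ h
-- consecutive cells. When a child needs a box, the node gives it half of one
-- of its own boxes, taking a new box from its parent only if no free half is
-- left. So every node has at most one free half box, and at most D * 2 ^ D
-- cells are wasted. A box of height h, of a node of length 2 ^ h / 2 ^ D, has
-- cost at most h * 2 ^ h / 2 ^ D, by induction on h, hence at most D at the root.
-- Thus the cost is O(D * (1 + ε) n / 2 ^ D), and taking D maximal with
-- D * 2 ^ D ≤ ε n makes this O((1 + ε) D² / ε) with D = O(log n).

module Submission where

open import Defs
open import Algebra.Bundles using (CommutativeRing)
import Algebra.Solver.Ring.NaturalCoefficients.Default
open import Data.Fin as Fin using (Fin; toℕ)
open import Data.List using (List; []; _∷_; _++_; _∷ʳ_; length; foldl; concat; catMaybes; replicate)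
import Data.List.Properties as Listₚ
open import Data.List.Relation.Ternary.Interleaving.Propositional using (Interleaving; []; consˡ; consʳ; swap)
open import Data.List.Relation.Ternary.Interleaving.Properties using (interleave-length)
open import Data.List.Relation.Unary.All as All using (All; []; _∷_)
import Data.List.Relation.Unary.All.Properties as Allₚ
open import Data.Maybe using (Maybe; just; nothing)
open import Data.Nat as ℕ using (ℕ; zero; suc; z≤n; s≤s)
open import Data.Nat.DivMod using (_mod_; m<n⇒m%n≡m)
import Data.Nat.Properties as ℕₚ
import Data.Nat.Solver as ℕSolver
open import Data.Fin.Properties using (toℕ-fromℕ<)
open import Data.Product using (_×_; _,_; ∃-syntax; Σ-syntax; proj₁; proj₂)
open import Data.Sum using (_⊎_; inj₁; inj₂)
open import Data.Vec as Vec using (Vec; []; _∷_; lookup; toList; _[_]≔_)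
import Data.Vec.Properties as Vecₚ
open import Relation.Binary.PropositionalEquality
open import Relation.Binary.Bundles using (Poset)
import Relation.Binary.Reasoning.PartialOrder
open import Relation.Binary.Structures using (IsDecTotalOrder)
open import Relation.Nullary using (¬_; Dec; yes; no; contradiction)
open import Relation.Nullary.Decidable using (_×-dec_)

-- Boxes of cells and writes to single cells

module _ {X : Set} where

  Cells : Set
  Cells = List (Maybe X)

  -- Built by doubling rather than by `replicate`, so that a fresh box is definitionally two fresh
  -- halves.
  blank : ℕ → Cells
  blank zero    = nothing ∷ []
  blank (suc h) = blank h ++ blank h

  data Write (x : X) : ℕ → Cells → Cells → Set where
    here  : ∀ {cs} → Write x 0 (nothing ∷ cs) (just x ∷ cs)
    there : ∀ {i c cs ds} → Write x i cs ds → Write x (suc i) (c ∷ cs) (c ∷ ds)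

  -- What one arriving element does to the boxes of a node: it fills a cell of a box already owned,
  -- or of a fresh box requested from above, which comes last.
  data Insertion (x : X) (h : ℕ) : List Cells → List Cells → Set where
    append : ∀ {i b} → Write x i (blank h) b → Insertion x h [] (b ∷ [])
    here   : ∀ {i b c bs} → Write x i b c → Insertion x h (b ∷ bs) (c ∷ bs)
    there  : ∀ {b bs cs} → Insertion x h bs cs → Insertion x h (b ∷ bs) (b ∷ cs)

  -- Recovers the boxes of a node from the halves handed out so far. After an odd number of halves,
  -- the last box still has its second half free.
  pairs : ℕ → List Cells → List Cells
  pairs h []           = []
  pairs h (b ∷ [])     = (b ++ blank h) ∷ []
  pairs h (b ∷ c ∷ bs) = (b ++ c) ∷ pairs h bs

  -- The interior of the array: the root boxes side by side, then the cells that no box has claimed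
  -- yet.
  tape : ℕ → List Cells → Cells
  tape k []       = replicate k nothing
  tape k (b ∷ bs) = b ++ tape (k ℕ.∸ length b) bs

  Write-++ʳ : ∀ {x i cs ds es} → Write x i cs ds → Write x i (cs ++ es) (ds ++ es)
  Write-++ʳ here      = here
  Write-++ʳ (there w) = there (Write-++ʳ w)

  Write-++ˡ : ∀ {x i cs ds} bs → Write x i cs ds → Write x (length bs ℕ.+ i) (bs ++ cs) (bs ++ ds)
  Write-++ˡ []       w = w
  Write-++ˡ (b ∷ bs) w = there (Write-++ˡ bs w)

  Write-length : ∀ {x i cs ds} → Write x i cs ds → length ds ≡ length cs
  Write-length here      = refl
  Write-length (there w) = cong suc (Write-length w)

  Write-index : ∀ {x i cs ds} → Write x i cs ds → i ℕ.< length cs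
  Write-index here      = s≤s z≤n
  Write-index (there w) = s≤s (Write-index w)

  -- The interleaving is the order in which the halves were handed out, so a fresh box of one child
  -- goes behind the boxes of both children.
  Insertion-interleave : ∀ {x h ls ls′ rs bs} → Insertion x h ls ls′ → Interleaving ls rs bs →
                         ∃[ bs′ ] Interleaving ls′ rs bs′ × Insertion x h bs bs′
  Insertion-interleave (append w) []         = _ , consˡ [] , append w
  Insertion-interleave (here w)   (consˡ sp) = _ , consˡ sp , here w
  Insertion-interleave (there s)  (consˡ sp) =
    let _ , sp′ , s′ = Insertion-interleave s sp in _ , consˡ sp′ , there s′
  Insertion-interleave s          (consʳ sp) =
    let _ , sp′ , s′ = Insertion-interleave s sp in _ , consʳ sp′ , there s′

  -- Parity decides: after an even number of halves, a fresh half opens a fresh box of the node;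
  -- after an odd number it fills the free half of the last box, and nothing is requested from
  -- above.
  Insertion-pairs : ∀ {x h bs bs′} → Insertion x h bs bs′ → Insertion x (suc h) (pairs h bs) (pairs h bs′)
  Insertion-pairs (append w)                         = append (Write-++ʳ w)
  Insertion-pairs (here {bs = []} w)                 = here (Write-++ʳ w)
  Insertion-pairs (here {bs = _ ∷ _} w)              = here (Write-++ʳ w)
  Insertion-pairs (there {b = b} (append w))         = here (Write-++ˡ b w)
  Insertion-pairs (there {b = b} (here w))           = here (Write-++ˡ b w)
  Insertion-pairs (there (there s))                  = there (Insertion-pairs s)

  -- The `suc` accounts for the one half that may be free.
  length-pairs : ∀ h (bs : List Cells) → 2 ℕ.* length (pairs h bs) ℕ.≤ suc (length bs)
  length-pairs h []           = z≤n
  length-pairs h (b ∷ [])     = ℕₚ.≤-refl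
  length-pairs h (b ∷ c ∷ bs) = ℕₚ.≤-trans
    (ℕₚ.≤-reflexive (ℕₚ.*-suc 2 (length (pairs h bs)))) (s≤s (s≤s (length-pairs h bs)))

  length-blank : ∀ h → length (blank h) ≡ 2 ℕ.^ h
  length-blank zero    = refl
  length-blank (suc h) = trans (Listₚ.length-++ (blank h))
    (cong₂ ℕ._+_ (length-blank h) (trans (length-blank h) (sym (ℕₚ.+-identityʳ _))))

  catMaybes-blank : ∀ h → catMaybes (blank h) ≡ []
  catMaybes-blank zero    = refl
  catMaybes-blank (suc h) = trans (Listₚ.catMaybes-++ (blank h) (blank h))
    (cong₂ _++_ (catMaybes-blank h) (catMaybes-blank h))

  blank-++-replicate : ∀ h k → length (blank h) ℕ.≤ k →
    replicate k nothing ≡ blank h ++ replicate (k ℕ.∸ length (blank h)) nothing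
  blank-++-replicate zero    (suc k) (s≤s _) = refl
  blank-++-replicate (suc h) k le = begin
    replicate k nothing
      ≡⟨ blank-++-replicate h k (ℕₚ.m+n≤o⇒m≤o b le′) ⟩
    blank h ++ replicate (k ℕ.∸ b) nothing
      ≡⟨ cong (blank h ++_) (blank-++-replicate h (k ℕ.∸ b)
           (ℕₚ.≤-trans (ℕₚ.≤-reflexive (sym (ℕₚ.m+n∸m≡n b b))) (ℕₚ.∸-monoˡ-≤ b le′))) ⟩
    blank h ++ blank h ++ replicate (k ℕ.∸ b ℕ.∸ b) nothing
      ≡⟨ Listₚ.++-assoc (blank h) (blank h) _ ⟨
    blank (suc h) ++ replicate (k ℕ.∸ b ℕ.∸ b) nothing
      ≡⟨ cong (λ j → blank (suc h) ++ replicate j nothing)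
           (trans (ℕₚ.∸-+-assoc k b b) (cong (k ℕ.∸_) (sym (Listₚ.length-++ (blank h))))) ⟩
    blank (suc h) ++ replicate (k ℕ.∸ length (blank (suc h))) nothing ∎
    where
    open ≡-Reasoning
    b = length (blank h)
    le′ : b ℕ.+ b ℕ.≤ k
    le′ = subst (ℕ._≤ k) (Listₚ.length-++ (blank h)) le

  position : ∀ {x h bs bs′} → Insertion x h bs bs′ → ℕ
  position (append {i} _)    = i
  position (here {i} _)      = i
  position (there {b = b} s) = length b ℕ.+ position s

  -- A fresh box starts where the unclaimed cells begin, and the bound on `concat bs′` ensures that
  -- it fits there. No other cell moves.
  Insertion⇒Write : ∀ {x h bs bs′} (s : Insertion x h bs bs′) k → length (concat bs′) ℕ.≤ k →
                    Write x (position s) (tape k bs) (tape k bs′)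
  Insertion⇒Write {x} {h} (append {i} {b} w) k le =
    subst₂ (Write x i)
      (sym (blank-++-replicate h k (ℕₚ.≤-trans (ℕₚ.≤-reflexive (trans (sym (Write-length w)) (sym |b|))) le)))
      (cong (λ j → b ++ replicate (k ℕ.∸ j) nothing) (sym (Write-length w)))
      (Write-++ʳ w)
    where
    |b| : length (b ++ []) ≡ length b
    |b| = cong length (Listₚ.++-identityʳ b)
  Insertion⇒Write {x} (here {i} {b} {c} {bs} w) k le =
    subst (λ j → Write x i (b ++ tape (k ℕ.∸ j) bs) (c ++ tape (k ℕ.∸ length c) bs))
      (Write-length w) (Write-++ʳ w)
  Insertion⇒Write (there {b} {cs = cs} s) k le =
    Write-++ˡ b (Insertion⇒Write s (k ℕ.∸ length b)
      (ℕₚ.≤-trans (ℕₚ.≤-reflexive (sym (trans (cong (ℕ._∸ length b) (Listₚ.length-++ b)) (ℕₚ.m+n∸m≡n (length b) _))))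
                  (ℕₚ.∸-monoˡ-≤ (length b) le)))

  Write⇒update : ∀ {m x i ds} (a : Vec (Maybe X) m) (j : Fin m) → toℕ j ≡ i → Write x i (toList a) ds →
                 lookup a j ≡ nothing × toList (a [ j ]≔ just x) ≡ ds
  Write⇒update (nothing ∷ a) Fin.zero    refl here      = refl , refl
  Write⇒update (c ∷ a)       (Fin.suc j) refl (there w) =
    let e , f = Write⇒update a j refl w in e , cong (c ∷_) f

  -- Distribution of boxes along the tree

  module _ {Node : Set} (In : ℕ → Node → X → Set) (left right : ℕ → Node → Node) where

    -- Layout h v n bs: the boxes of 2 ^ h cells that node v of height h has
    -- received so far, in that order, with the n elements they hold. A node
    -- hands out the two halves of its boxes, in order, to its children.
    data Layout : ℕ → Node → ℕ → List Cells → Set where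
      []   : ∀ {v} → Layout 0 v 0 []
      _∷_  : ∀ {v x n bs} → In 0 v x → Layout 0 v n bs → Layout 0 v (suc n) ((just x ∷ []) ∷ bs)
      node : ∀ {h v m n ls rs bs} → Layout h (left h v) m ls → Layout h (right h v) n rs →
             Interleaving ls rs bs → Layout (suc h) v (m ℕ.+ n) (pairs h bs)

    emptyLayout : ∀ h v → Layout h v 0 []
    emptyLayout zero    v = []
    emptyLayout (suc h) v = node (emptyLayout h _) (emptyLayout h _) []

    -- The element descends to a leaf, which always requests a fresh cell. On the way back, each
    -- node turns the insertion into its child's boxes into one into its own.
    insert : (∀ h v x → In (suc h) v x → In h (left h v) x ⊎ In h (right h v) x) →
             ∀ {h v n bs x} → Layout h v n bs → In h v x → ∃[ bs′ ] Layout h v (suc n) bs′ × Insertion x h bs bs′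
    insert split []       q = _ , q ∷ [] , append here
    insert split (p ∷ ps) q = let _ , ps′ , s = insert split ps q in _ , p ∷ ps′ , there s
    insert split (node {h} {v} {m} {n} l r sp) q with split h v _ q
    ... | inj₁ ql =
      let _ , l′ , s = insert split l ql
          _ , sp′ , s′ = Insertion-interleave s sp
      in _ , node l′ r sp′ , Insertion-pairs s′
    ... | inj₂ qr =
      let _ , r′ , s = insert split r qr
          -- `Insertion-interleave` changes the left list, so the children trade places here and are
          -- swapped back below.
          bs′ , sp′ , s′ = Insertion-interleave s (swap sp)
      in pairs h bs′ ,
         subst (λ j → Layout (suc h) v j (pairs h bs′)) (ℕₚ.+-suc m n) (node l r′ (swap sp′)) ,
         Insertion-pairs s′

    -- The term `h * 2 ^ h` bounds the empty cells: those of the two children, and the at most one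
    -- free half of the node itself.
    Layout-capacity : ∀ {h v n bs} → Layout h v n bs → length bs ℕ.* 2 ℕ.^ h ℕ.≤ n ℕ.+ h ℕ.* 2 ℕ.^ h
    Layout-capacity []       = z≤n
    Layout-capacity (p ∷ ps) = s≤s (Layout-capacity ps)
    Layout-capacity (node {h} {v} {m} {n} {ls} {rs} {bs} l r sp) = begin
      length (pairs h bs) ℕ.* (2 ℕ.* s)
        ≡⟨ ℕₚ.*-assoc (length (pairs h bs)) 2 s ⟨
      length (pairs h bs) ℕ.* 2 ℕ.* s
        ≤⟨ ℕₚ.*-monoˡ-≤ s (ℕₚ.≤-trans (ℕₚ.≤-reflexive (ℕₚ.*-comm (length (pairs h bs)) 2)) (length-pairs h bs)) ⟩
      suc (length bs) ℕ.* s
        ≡⟨ cong (λ j → suc j ℕ.* s) (interleave-length sp) ⟩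
      s ℕ.+ (length ls ℕ.+ length rs) ℕ.* s
        ≡⟨ cong (s ℕ.+_) (ℕₚ.*-distribʳ-+ s (length ls) (length rs)) ⟩
      s ℕ.+ (length ls ℕ.* s ℕ.+ length rs ℕ.* s)
        -- The free half `s` is rounded up to `s + s`, so that the sum closes up to
        -- `suc h * (2 * s)`.
        ≤⟨ ℕₚ.+-mono-≤ (ℕₚ.m≤m+n s s) (ℕₚ.+-mono-≤ (Layout-capacity l) (Layout-capacity r)) ⟩
      s ℕ.+ s ℕ.+ (m ℕ.+ h ℕ.* s ℕ.+ (n ℕ.+ h ℕ.* s))
        ≡⟨ solve 4 (λ m n h s → s :+ s :+ (m :+ h :* s :+ (n :+ h :* s)) :=
                                m :+ n :+ (con 1 :+ h) :* (con 2 :* s)) refl m n h s ⟩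
      m ℕ.+ n ℕ.+ suc h ℕ.* (2 ℕ.* s) ∎
      where
      open ℕₚ.≤-Reasoning
      open ℕSolver.+-*-Solver
      s = 2 ℕ.^ h

-- Arithmetic in ordered fields

module OrderedFieldProperties (F : OrderedField) where
  open OrderedField F
  open CommutativeRing commutativeRing
    using (+-identityˡ; +-identityʳ; +-comm; +-assoc; -‿inverseʳ; -‿inverseˡ; *-assoc; *-comm;
           *-identityʳ; zeroˡ; zeroʳ; distribʳ; ring; semiring; commutativeSemiring)
  open import Algebra.Properties.Ring ring using (-‿distribʳ-*; -‿distribˡ-*; -‿involutive; -‿+-comm)
  open import Algebra.Properties.Semiring.Mult semiring using (×1-homo-*; ×-homo-+)
  module Solver = Algebra.Solver.Ring.NaturalCoefficients.Default commutativeSemiring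

  ≤-poset : Poset _ _ _
  ≤-poset = record { isPartialOrder = IsDecTotalOrder.isPartialOrder isDecTotalOrder }

  module ≤-Reasoning = Relation.Binary.Reasoning.PartialOrder ≤-poset

  ≰⇒≥ : ∀ {x y} → ¬ (x ≤ y) → y ≤ x
  ≰⇒≥ {x} {y} x≰y with total x y
  ... | inj₁ p = contradiction p x≰y
  ... | inj₂ p = p

  +-monoʳ-≤ : ∀ z {x y} → x ≤ y → z + x ≤ z + y
  +-monoʳ-≤ z p = subst₂ _≤_ (+-comm _ z) (+-comm _ z) (+-monoˡ-≤ z p)

  +-mono-≤ : ∀ {x y z w} → x ≤ y → z ≤ w → x + z ≤ y + w
  +-mono-≤ {y = y} {z} p q = ≤-trans (+-monoˡ-≤ z p) (+-monoʳ-≤ y q)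

  x≤y+x : ∀ {x y} → 0# ≤ y → x ≤ y + x
  x≤y+x {x} {y} p = subst (_≤ y + x) (+-identityˡ x) (+-monoˡ-≤ x p)

  x≤x+y : ∀ {x y} → 0# ≤ y → x ≤ x + y
  x≤x+y {x} {y} p = subst (x ≤_) (+-comm y x) (x≤y+x p)

  ≤⇒0≤- : ∀ {x y} → x ≤ y → 0# ≤ y - x
  ≤⇒0≤- {x} {y} p = subst (_≤ y - x) (-‿inverseʳ x) (+-monoˡ-≤ (- x) p)

  -‿cancelʳ : ∀ x y → x - y + y ≡ x
  -‿cancelʳ x y = trans (+-assoc x (- y) y) (trans (cong (x +_) (-‿inverseˡ y)) (+-identityʳ x))

  +-‿cancelʳ : ∀ x y → x + y - y ≡ x
  +-‿cancelʳ x y = trans (+-assoc x y (- y)) (trans (cong (x +_) (-‿inverseʳ y)) (+-identityʳ x))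

  0≤-⇒≤ : ∀ {x y} → 0# ≤ y - x → x ≤ y
  0≤-⇒≤ {x} {y} p = subst₂ _≤_ (+-identityˡ x) (-‿cancelʳ y x) (+-monoˡ-≤ x p)

  x≤y+z⇒x-y≤z : ∀ {x y z} → x ≤ y + z → x - y ≤ z
  x≤y+z⇒x-y≤z {x} {y} {z} p = subst (x - y ≤_) eq (+-monoˡ-≤ (- y) p)
    where
    eq : y + z - y ≡ z
    eq = trans (cong (_- y) (+-comm y z)) (+-‿cancelʳ z y)

  *-monoˡ-≤ : ∀ {x y z} → 0# ≤ z → x ≤ y → x * z ≤ y * z
  *-monoˡ-≤ {x} {y} {z} 0≤z x≤y = 0≤-⇒≤ (subst (0# ≤_)
    (trans (distribʳ z y (- x)) (cong (y * z +_) (sym (-‿distribˡ-* x z))))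
    (*-nonNegative (≤⇒0≤- x≤y) 0≤z))

  *-monoʳ-≤ : ∀ {x y z} → 0# ≤ z → x ≤ y → z * x ≤ z * y
  *-monoʳ-≤ {z = z} 0≤z p = subst₂ _≤_ (*-comm _ z) (*-comm _ z) (*-monoˡ-≤ 0≤z p)

  *-mono-≤ : ∀ {x y z w} → 0# ≤ y → 0# ≤ z → x ≤ y → z ≤ w → x * z ≤ y * w
  *-mono-≤ 0≤y 0≤z p q = ≤-trans (*-monoˡ-≤ 0≤z p) (*-monoʳ-≤ 0≤y q)

  0≤1 : 0# ≤ 1#
  0≤1 with total 0# 1#
  ... | inj₁ p = p
  ... | inj₂ p = subst (0# ≤_) -1*-1≡1 (*-nonNegative 0≤-1 0≤-1)
    where
    0≤-1 : 0# ≤ - 1#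
    0≤-1 = subst (0# ≤_) (+-identityˡ (- 1#)) (≤⇒0≤- p)
    -1*-1≡1 : (- 1#) * (- 1#) ≡ 1#
    -1*-1≡1 = trans (sym (-‿distribʳ-* (- 1#) 1#))
      (trans (cong -_ (*-identityʳ (- 1#))) (-‿involutive 1#))

  0≤fromℕ : ∀ n → 0# ≤ fromℕ n
  0≤fromℕ zero    = ≤-refl
  0≤fromℕ (suc n) = ≤-trans (0≤fromℕ n) (x≤y+x 0≤1)

  fromℕ-mono : ∀ {m n} → m ℕ.≤ n → fromℕ m ≤ fromℕ n
  fromℕ-mono {n = n} z≤n     = 0≤fromℕ n
  fromℕ-mono (s≤s m≤n) = +-monoʳ-≤ 1# (fromℕ-mono m≤n)

  fromℕ-+ : ∀ m n → fromℕ (m ℕ.+ n) ≡ fromℕ m + fromℕ n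
  fromℕ-+ = ×-homo-+ 1#

  fromℕ-* : ∀ m n → fromℕ (m ℕ.* n) ≡ fromℕ m * fromℕ n
  fromℕ-* = ×1-homo-*

  fromℕ-1 : fromℕ 1 ≡ 1#
  fromℕ-1 = +-identityʳ 1#

  1≤fromℕ-suc : ∀ n → 1# ≤ fromℕ (suc n)
  1≤fromℕ-suc n = x≤x+y (0≤fromℕ n)

  1+x≰x : ∀ {x} → ¬ (1# + x ≤ x)
  1+x≰x {x} p = 0≢1 (antisym 0≤1 (subst₂ _≤_ (+-‿cancelʳ 1# x) (-‿inverseʳ x) (+-monoˡ-≤ (- x) p)))

  -- If `n < m`, the images differ by at least one, which `1+x≰x` forbids.
  fromℕ-cancel-≤ : ∀ {m n} → fromℕ m ≤ fromℕ n → m ℕ.≤ n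
  fromℕ-cancel-≤ {m} {n} p with m ℕ.≤? n
  ... | yes m≤n = m≤n
  ... | no  m≰n = contradiction (≤-trans (fromℕ-mono (ℕₚ.≰⇒> m≰n)) p) 1+x≰x

  1≤⇒0< : ∀ {x} → 1# ≤ x → 0# < x
  1≤⇒0< p = ≤-trans 0≤1 p , λ { refl → 0≢1 (antisym 0≤1 p) }

  <-≤-trans : ∀ {x y z} → x < y → y ≤ z → x < z
  <-≤-trans (p , x≢y) q = ≤-trans p q , λ { refl → x≢y (antisym p q) }

  *-inverse : ∀ {x} → 0# < x → x * x ⁻¹ ≡ 1#
  *-inverse (_ , 0≢x) = *-inverseʳ _ (λ eq → 0≢x (sym eq))

  -- A nonpositive inverse, multiplied by `x`, would give `1# ≤ 0#`.
  0<⇒0≤⁻¹ : ∀ {x} → 0# < x → 0# ≤ x ⁻¹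
  0<⇒0≤⁻¹ {x} 0<x with total 0# (x ⁻¹)
  ... | inj₁ p = p
  ... | inj₂ p = contradiction (antisym 0≤1 1≤0) 0≢1
    where
    1≤0 : 1# ≤ 0#
    1≤0 = subst₂ _≤_ (*-inverse 0<x) (zeroʳ x) (*-monoʳ-≤ (proj₁ 0<x) p)

  0<⇒0<⁻¹ : ∀ {x} → 0# < x → 0# < x ⁻¹
  0<⇒0<⁻¹ {x} 0<x = 0<⇒0≤⁻¹ 0<x , λ eq →
    0≢1 (trans (sym (zeroʳ x)) (trans (cong (x *_) eq) (*-inverse 0<x)))

  0<* : ∀ {x y} → 0# < x → 0# < y → 0# < x * y
  0<* {x} {y} (p , 0≢x) 0<y = *-nonNegative p (proj₁ 0<y) , λ eq → 0≢x (begin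
    0#            ≡⟨ zeroˡ (y ⁻¹) ⟨
    0# * y ⁻¹     ≡⟨ cong (_* y ⁻¹) eq ⟩
    x * y * y ⁻¹  ≡⟨ *-assoc x y (y ⁻¹) ⟩
    x * (y * y ⁻¹) ≡⟨ cong (x *_) (*-inverse 0<y) ⟩
    x * 1#        ≡⟨ *-identityʳ x ⟩
    x             ∎)
    where open ≡-Reasoning

  *≤⇒≤/ : ∀ {x y z} → 0# < z → x * z ≤ y → x ≤ y / z
  *≤⇒≤/ {x} {y} {z} 0<z p = subst (_≤ y / z) eq (*-monoˡ-≤ (0<⇒0≤⁻¹ 0<z) p)
    where
    eq : x * z * z ⁻¹ ≡ x
    eq = trans (*-assoc x z _) (trans (cong (x *_) (*-inverse 0<z)) (*-identityʳ x))

  *-cancelʳ-≤ : ∀ {x y z} → 0# < z → x * z ≤ y * z → x ≤ y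
  *-cancelʳ-≤ {x} {y} {z} 0<z p = subst (x ≤_)
    (trans (*-assoc y z _) (trans (cong (y *_) (*-inverse 0<z)) (*-identityʳ y))) (*≤⇒≤/ 0<z p)

  0<2^ : ∀ h → 0# < fromℕ (2 ℕ.^ h)
  0<2^ h = 1≤⇒0< (subst (_≤ fromℕ (2 ℕ.^ h)) fromℕ-1 (fromℕ-mono (ℕₚ.m^n>0 2 h)))

  fromℕ-2^suc : ∀ h → fromℕ (2 ℕ.^ suc h) ≡ fromℕ (2 ℕ.^ h) + fromℕ (2 ℕ.^ h)
  fromℕ-2^suc h = trans (cong (λ j → fromℕ (2 ℕ.^ h ℕ.+ j)) (ℕₚ.+-identityʳ (2 ℕ.^ h))) (fromℕ-+ (2 ℕ.^ h) (2 ℕ.^ h))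

  -‿anticomm : ∀ x y → - (x - y) ≡ y - x
  -‿anticomm x y = trans (sym (-‿+-comm x (- y))) (trans (cong (- x +_) (-‿involutive y)) (+-comm (- x) y))

  ∣-∣≤ : ∀ {l w x y} → l ≤ x × x ≤ l + w → l ≤ y × y ≤ l + w → ∣ x - y ∣ ≤ w
  ∣-∣≤ {l} {w} {x} {y} (l≤x , x≤u) (l≤y , y≤u) with 0# ≤? (x - y)
  ... | yes _ = x≤y+z⇒x-y≤z (≤-trans x≤u (+-monoˡ-≤ w l≤y))
  ... | no  _ = subst (_≤ w) (sym (-‿anticomm x y)) (x≤y+z⇒x-y≤z (≤-trans y≤u (+-monoˡ-≤ w l≤x)))

-- Lower bounds on the logarithm

module Logarithm (R : Reals) where
  open Reals R
  open Log₂ R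
  open OrderedFieldProperties orderedField
  open CommutativeRing commutativeRing using (*-identityˡ; *-identityʳ)

  -- The fraction `p / 1` belongs to the set whose supremum is `log₂ n`; `BelowLog₂` writes
  -- denominators as `suc q`, hence the witness 0.
  fromℕ≤log₂ : ∀ p {n} → 1 ℕ.≤ n → 2 ℕ.^ p ℕ.≤ n → fromℕ p ≤ log₂ n
  fromℕ≤log₂ p {suc n} _ le = proj₁ (log₂-supremum n) (fromℕ p)
    (p , 0 , sym p/1≡p , subst (2 ℕ.^ p ℕ.≤_) (sym (ℕₚ.*-identityʳ (suc n))) le)
    where
    1⁻¹≡1 : fromℕ 1 ⁻¹ ≡ 1#
    1⁻¹≡1 = trans (sym (*-identityˡ _))
      (trans (cong (_* fromℕ 1 ⁻¹) (sym fromℕ-1)) (*-inverse (1≤⇒0< (1≤fromℕ-suc 0))))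
    p/1≡p : fromℕ p / fromℕ 1 ≡ fromℕ p
    p/1≡p = trans (cong (fromℕ p *_) 1⁻¹≡1) (*-identityʳ _)

  1≤log₂ : ∀ {n} → 2 ℕ.≤ n → 1# ≤ log₂ n
  1≤log₂ {n} 2≤n = subst (_≤ log₂ n) fromℕ-1 (fromℕ≤log₂ 1 (ℕₚ.≤-trans (s≤s z≤n) 2≤n) 2≤n)

-- Cost of boxes of dyadic intervals

module DyadicSorting (R : Reals) where
  open Reals R
  open OnlineSorting R
  open OrderedFieldProperties orderedField
  open CommutativeRing commutativeRing
    using (+-identityˡ; +-assoc; +-comm; *-identityˡ; *-identityʳ; zeroˡ; distribʳ)

  Within : ℝ → ℝ → ℝ → Set
  Within l w x = l ≤ x × x ≤ l + w

  -- At most one new pair of neighbours arises, at the seam, and both lie in an interval of length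
  -- `w`.
  variation-++ : ∀ {l w xs ys} → 0# ≤ w → All (Within l w) xs → All (Within l w) ys →
                 variation (xs ++ ys) ≤ variation xs + (variation ys + w)
  variation-++ {w = w} {ys = ys} 0≤w [] qs =
    subst (variation ys ≤_) (sym (+-identityˡ _)) (x≤x+y 0≤w)
  variation-++ 0≤w (p ∷ []) [] = subst (0# ≤_) (sym (trans (+-identityˡ _) (+-identityˡ _))) 0≤w
  variation-++ {w = w} 0≤w (p ∷ []) (_∷_ {y} {ys} q qs) =
    ≤-trans (+-monoˡ-≤ _ (∣-∣≤ p q)) (≤-reflexive (trans (+-comm w _) (sym (+-identityˡ _))))
  variation-++ 0≤w (p ∷ p′ ∷ ps) qs =
    ≤-trans (+-monoʳ-≤ _ (variation-++ 0≤w (p′ ∷ ps) qs)) (≤-reflexive (sym (+-assoc _ _ _)))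

  catMaybes-replicate : ∀ k → catMaybes (replicate k (nothing {A = ℝ})) ≡ []
  catMaybes-replicate zero    = refl
  catMaybes-replicate (suc k) = catMaybes-replicate k

  All-catMaybes-++ : ∀ {P : ℝ → Set} bs cs →
                     All P (catMaybes bs) → All P (catMaybes cs) → All P (catMaybes (bs ++ cs))
  All-catMaybes-++ bs cs p q = subst (All _) (sym (Listₚ.catMaybes-++ bs cs)) (Allₚ.++⁺ p q)

  Interleaving-All : ∀ {A : Set} {P : A → Set} {ls rs bs} → All P ls → All P rs → Interleaving ls rs bs → All P bs
  Interleaving-All []       []       []         = []
  Interleaving-All (p ∷ ps) qs       (consˡ sp) = p ∷ Interleaving-All ps qs sp
  Interleaving-All ps       (q ∷ qs) (consʳ sp) = q ∷ Interleaving-All ps qs sp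

  module _ (D : ℕ) where

    -- The node l of height h is the dyadic interval [ l , l + width h ].
    width : ℕ → ℝ
    width h = fromℕ (2 ℕ.^ h) / fromℕ (2 ℕ.^ D)

    0≤width : ∀ h → 0# ≤ width h
    0≤width h = *-nonNegative (0≤fromℕ (2 ℕ.^ h)) (0<⇒0≤⁻¹ (0<2^ D))

    width-suc : ∀ h → width (suc h) ≡ width h + width h
    width-suc h = trans (cong (_/ fromℕ (2 ℕ.^ D)) (fromℕ-2^suc h)) (distribʳ _ _ _)

    width-top : width D ≡ 1#
    width-top = *-inverse (0<2^ D)

    In : ℕ → ℝ → ℝ → Set
    In h l = Within l (width h)

    left right : ℕ → ℝ → ℝ
    left  _ l = l
    right h l = l + width h

    top≡ : ∀ h l → l + width h + width h ≡ l + width (suc h)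
    top≡ h l = trans (+-assoc l _ _) (cong (l +_) (sym (width-suc h)))

    split : ∀ h l x → In (suc h) l x → In h (left h l) x ⊎ In h (right h l) x
    split h l x (l≤x , x≤u) with total x (l + width h)
    ... | inj₁ p = inj₁ (l≤x , p)
    ... | inj₂ p = inj₂ (p , subst (x ≤_) (sym (top≡ h l)) x≤u)

    left⊆ : ∀ {h l x} → In h (left h l) x → In (suc h) l x
    left⊆ {h} {l} (p , q) = p , ≤-trans q (subst (l + width h ≤_) (top≡ h l) (x≤x+y (0≤width h)))

    right⊆ : ∀ {h l x} → In h (right h l) x → In (suc h) l x
    right⊆ {h} {l} {x} (p , q) = ≤-trans (x≤x+y (0≤width h)) p , subst (x ≤_) (top≡ h l) q

    -- h * width h solves c (h + 1) = 2 * c h + width (h + 1): the cost of the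
    -- two halves and of one jump between them.
    record Tight (P : ℝ → Set) (h : ℕ) (b : Cells) : Set where
      constructor tight
      field
        size  : length b ≡ 2 ℕ.^ h
        holds : All P (catMaybes b)
        bound : variation (catMaybes b) ≤ fromℕ h * width h

    tight-mono : ∀ {P Q : ℝ → Set} {h b} → (∀ {x} → P x → Q x) → Tight P h b → Tight Q h b
    tight-mono f (tight s p v) = tight s (All.map f p) v

    tight-blank : ∀ {P} h → Tight P h (blank h)
    tight-blank h = tight (length-blank h) (subst (All _) (sym (catMaybes-blank h)) [])
      (subst (λ xs → variation xs ≤ fromℕ h * width h) (sym (catMaybes-blank h))
        (*-nonNegative (0≤fromℕ h) (0≤width h)))

    tight-++ : ∀ {h l b c} → Tight (In (suc h) l) h b → Tight (In (suc h) l) h c →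
               Tight (In (suc h) l) (suc h) (b ++ c)
    tight-++ {h} {l} {b} {c} (tight s p v) (tight s′ p′ v′) = tight
      (trans (Listₚ.length-++ b) (cong₂ ℕ._+_ s (trans s′ (sym (ℕₚ.+-identityʳ _)))))
      (All-catMaybes-++ b c p p′)
      (subst (λ xs → variation xs ≤ fromℕ (suc h) * width (suc h)) (sym (Listₚ.catMaybes-++ b c))
        (≤-trans (variation-++ (0≤width (suc h)) p p′)
          (≤-trans (+-mono-≤ v (+-monoˡ-≤ _ v′)) (≤-reflexive eq))))
      where
      eq : fromℕ h * width h + (fromℕ h * width h + width (suc h)) ≡ fromℕ (suc h) * width (suc h)
      eq = subst (λ w → fromℕ h * width h + (fromℕ h * width h + w) ≡ fromℕ (suc h) * w) (sym (width-suc h))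
        -- `fromℕ (suc h)` unfolds to `1# + fromℕ h`, so `1#` is made a factor and enters the solver
        -- as the atom `o`.
        (trans (cong (λ w → fromℕ h * width h + (fromℕ h * width h + w)) (sym (*-identityˡ _)))
          (solve 3 (λ o h w → h :* w :+ (h :* w :+ o :* (w :+ w)) := (o :+ h) :* (w :+ w))
            refl 1# (fromℕ h) (width h)))
        where open Solver

    tight-pairs : ∀ {h l bs} → All (Tight (In (suc h) l) h) bs → All (Tight (In (suc h) l) (suc h)) (pairs h bs)
    tight-pairs []           = []
    tight-pairs (p ∷ [])     = tight-++ p (tight-blank _) ∷ []
    tight-pairs (p ∷ q ∷ ps) = tight-++ p q ∷ tight-pairs ps

    -- The two halves of a box may belong to different children, so the elements of both are first
    -- viewed in the parent's interval.
    Layout-tight : ∀ {h l n bs} → Layout In left right h l n bs → All (Tight (In h l) h) bs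
    Layout-tight []       = []
    Layout-tight (p ∷ ps) =
      tight refl (p ∷ []) (≤-reflexive (sym (zeroˡ _))) ∷ Layout-tight ps
    Layout-tight (node {h} p q sp) = tight-pairs (Interleaving-All
      (All.map (tight-mono (left⊆ {h})) (Layout-tight p))
      (All.map (tight-mono (right⊆ {h})) (Layout-tight q)) sp)

    InRoot : ℝ → Set
    InRoot = Within 0# 1#

    -- As `width D` is 1, each root box costs at most `D`, and the jump to the box after it at most
    -- 1.
    tape-variation : ∀ k {bs} → All (Tight InRoot D) bs →
      All InRoot (catMaybes (tape k bs)) × variation (catMaybes (tape k bs)) ≤ fromℕ (length bs) * fromℕ (suc D)
    tape-variation k [] rewrite catMaybes-replicate k = [] , ≤-reflexive (sym (zeroˡ _))
    tape-variation k (_∷_ {b} {bs} (tight _ p v) ps) with tape-variation (k ℕ.∸ length b) ps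
    ... | q , w = All-catMaybes-++ b rest p q ,
      subst (λ xs → variation xs ≤ _) (sym (Listₚ.catMaybes-++ b rest))
        (≤-trans (variation-++ 0≤1 p q) (≤-trans (+-mono-≤ v′ (+-monoˡ-≤ 1# w)) (≤-reflexive eq)))
      where
      rest = tape (k ℕ.∸ length b) bs
      v′ : variation (catMaybes b) ≤ fromℕ D
      v′ = subst (variation (catMaybes b) ≤_) (trans (cong (fromℕ D *_) width-top) (*-identityʳ _)) v
      eq : fromℕ D + (fromℕ (length bs) * fromℕ (suc D) + 1#) ≡ fromℕ (suc (length bs)) * fromℕ (suc D)
      eq = trans (solve 3 (λ o d m → d :+ (m :+ o) := o :+ d :+ m)
                    refl 1# (fromℕ D) (fromℕ (length bs) * fromℕ (suc D)))
        (trans (cong (_+ fromℕ (length bs) * fromℕ (suc D)) (sym (*-identityˡ _))) (sym (distribʳ _ _ _)))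
        where open Solver

    -- The online algorithm and its run

    module _ (k : ℕ) where

      record State : Set where
        constructor state
        field
          {count} : ℕ
          {boxes} : List Cells
          layout  : Layout In left right D 0# count boxes
      open State

      inRoot? : ∀ x → Dec (In D 0# x)
      inRoot? x = (0# ≤? x) ×-dec (x ≤? (0# + width D))

      -- The default cell 0 is never used on inputs from the unit interval.
      step : State → ℝ → State × Fin (2 ℕ.+ k)
      step s x with inRoot? x
      ... | no  _ = s , Fin.zero
      ... | yes p = let _ , layout′ , i = insert In left right split (layout s) p
                    in state layout′ , suc (position i) mod (2 ℕ.+ k)

      -- An `OnlineAlgorithm` is given only the past elements, so its state is rebuilt by replaying
      -- them.
      after : List ℝ → State
      after = foldl (λ s x → proj₁ (step s x)) (state (emptyLayout In left right D 0#))

      sorter : OnlineAlgorithm (2 ℕ.+ k)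
      sorter past x = proj₂ (step (after past) x)

      -- The contents that the array must have in a given state: the invariant of the run.
      cells : State → Cells
      cells s = just 0# ∷ (tape k (boxes s) ++ just 1# ∷ [])

      length-concat : ∀ {P bs} → All (Tight P D) bs → length (concat bs) ≡ length bs ℕ.* 2 ℕ.^ D
      length-concat [] = refl
      length-concat {bs = b ∷ bs} (p ∷ ps) =
        trans (Listₚ.length-++ b) (cong₂ ℕ._+_ (Tight.size p) (length-concat ps))

      -- By `Layout-capacity`, the boxes after the insertion occupy at most
      -- `suc (count s) + D * 2 ^ D` cells, so even a fresh root box fits.
      step-sound : ∀ s {x} (a : Array (2 ℕ.+ k)) → toList a ≡ cells s → InUnitInterval x →
        suc (count s) ℕ.+ D ℕ.* 2 ℕ.^ D ℕ.≤ k →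
        count (proj₁ (step s x)) ≡ suc (count s) ×
        lookup a (proj₂ (step s x)) ≡ nothing ×
        toList (a [ proj₂ (step s x) ]≔ just x) ≡ cells (proj₁ (step s x))
      step-sound s {x} a inv (0≤x , x≤1) room with inRoot? x
      -- The root interval is the whole unit interval, so the default case cannot occur.
      ... | no ¬p = contradiction (0≤x , subst (x ≤_) (sym (trans (+-identityˡ _) width-top)) x≤1) ¬p
      ... | yes p with insert In left right split (layout s) p
      ... | bs′ , layout′ , i = refl , Write⇒update a _ index w
        where
        fits : length (concat bs′) ℕ.≤ k
        fits = ℕₚ.≤-trans (ℕₚ.≤-reflexive (length-concat (Layout-tight layout′)))
          (ℕₚ.≤-trans (Layout-capacity In left right layout′) room)
        w : Write x (suc (position i)) (toList a) (cells (state layout′))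
        w = subst (λ cs → Write x (suc (position i)) cs (cells (state layout′))) (sym inv)
          (there (Write-++ʳ (Insertion⇒Write i k fits)))
        -- The write lies inside the array, so the `mod` in `step`, which only serves to produce a
        -- `Fin`, changes nothing. The `suc` skips the sentinel 0.
        index : toℕ (suc (position i) mod (2 ℕ.+ k)) ≡ suc (position i)
        index = trans (toℕ-fromℕ< _) (m<n⇒m%n≡m
          (subst (suc (position i) ℕ.<_) (Vecₚ.length-toList a) (Write-index w)))

      -- The required room counts the elements placed and those to come together, so it stays
      -- constant along the run.
      run-sound : ∀ past xs (a : Array (2 ℕ.+ k)) → toList a ≡ cells (after past) → All InUnitInterval xs →
        count (after past) ℕ.+ length xs ℕ.+ D ℕ.* 2 ℕ.^ D ℕ.≤ k →
        ∃[ b ] run sorter past xs a ≡ just b ×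
          ∃[ s ] toList b ≡ cells s × count s ≡ count (after past) ℕ.+ length xs
      run-sound past [] a inv [] room = a , refl , after past , inv , sym (ℕₚ.+-identityʳ _)
      run-sound past (x ∷ xs) a inv (p ∷ ps) room
        with step-sound (after past) a inv p
               (ℕₚ.≤-trans (ℕₚ.+-monoˡ-≤ (D ℕ.* 2 ℕ.^ D) (ℕₚ.≤-trans (ℕₚ.m≤m+n (suc (count (after past))) (length xs))
                 (ℕₚ.≤-reflexive (sym (ℕₚ.+-suc (count (after past)) (length xs)))))) room)
      -- Once the chosen cell is known to be empty, `run` reduces to a run on the rest of the input.
      ... | count≡ , free , inv′ rewrite free =
        let b , run≡ , s , final , total = run-sound (past ∷ʳ x) xs (a [ sorter past x ]≔ just x)
              (trans inv′ (cong cells (sym after-∷ʳ))) ps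
              (subst (λ m → m ℕ.+ D ℕ.* 2 ℕ.^ D ℕ.≤ k) (sym count-shift) room)
        in b , run≡ , s , final , trans total count-shift
        where
        after-∷ʳ : after (past ∷ʳ x) ≡ proj₁ (step (after past) x)
        after-∷ʳ = Listₚ.foldl-∷ʳ _ _ x past
        count-shift : count (after (past ∷ʳ x)) ℕ.+ length xs ≡ count (after past) ℕ.+ suc (length xs)
        count-shift = trans (cong (ℕ._+ length xs) (trans (cong count after-∷ʳ) count≡)) (sym (ℕₚ.+-suc _ _))

      -- The sentinels add two jumps of length at most 1; each is charged `fromℕ (suc D)`, to share
      -- the factor of the boxes.
      cells-variation : ∀ s → variation (catMaybes (cells s)) ≤ (fromℕ (length (boxes s)) + (1# + 1#)) * fromℕ (suc D)
      cells-variation s = begin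
        variation (0# ∷ catMaybes (t ++ just 1# ∷ []))
          ≡⟨ cong (λ xs → variation (0# ∷ xs)) (Listₚ.catMaybes-++ t (just 1# ∷ [])) ⟩
        variation ((0# ∷ []) ++ (catMaybes t ++ 1# ∷ []))
          ≤⟨ variation-++ 0≤1 (0∈ ∷ []) (Allₚ.++⁺ holds (1∈ ∷ [])) ⟩
        0# + (variation (catMaybes t ++ 1# ∷ []) + 1#)
          ≤⟨ +-monoʳ-≤ 0# (+-monoˡ-≤ 1# (variation-++ 0≤1 holds (1∈ ∷ []))) ⟩
        0# + (variation (catMaybes t) + (0# + 1#) + 1#)
          ≡⟨ trans (+-identityˡ _)
               (trans (cong (λ o → variation (catMaybes t) + o + 1#) (+-identityˡ 1#)) (+-assoc _ 1# 1#)) ⟩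
        variation (catMaybes t) + (1# + 1#)
          ≤⟨ +-mono-≤ bound (subst (_≤ (1# + 1#) * d) (*-identityʳ _)
               (*-monoʳ-≤ (≤-trans 0≤1 (x≤x+y 0≤1)) (1≤fromℕ-suc D))) ⟩
        M * d + (1# + 1#) * d
          ≡⟨ distribʳ d M (1# + 1#) ⟨
        (M + (1# + 1#)) * d ∎
        where
        open ≤-Reasoning
        t = tape k (boxes s)
        M = fromℕ (length (boxes s))
        d = fromℕ (suc D)
        toRoot : ∀ {x} → In D 0# x → InRoot x
        toRoot = subst (λ w → Within 0# w _) width-top
        0∈ : InRoot 0#
        0∈ = ≤-refl , x≤x+y 0≤1
        1∈ : InRoot 1#
        1∈ = 0≤1 , x≤y+x ≤-refl
        tapeBound = tape-variation k (All.map (tight-mono toRoot) (Layout-tight (layout s)))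
        holds = proj₁ tapeBound
        bound = proj₂ tapeBound

      -- Here `m` is the number of root boxes; its bound is passed on so that `cost-estimate` can
      -- trade boxes for `ε`.
      sorter-sound : ∀ xs → All InUnitInterval xs → length xs ℕ.+ D ℕ.* 2 ℕ.^ D ℕ.≤ k →
        ∃[ b ] run sorter [] xs (initial k) ≡ just b ×
          ∃[ m ] m ℕ.* 2 ℕ.^ D ℕ.≤ length xs ℕ.+ D ℕ.* 2 ℕ.^ D ×
                 cost b ≤ (fromℕ m + (1# + 1#)) * fromℕ (suc D)
      sorter-sound xs ps room =
        let b , run≡ , s , final , total = run-sound [] xs (initial k) start ps room
        in b , run≡ , length (boxes s) ,
           subst (λ n → length (boxes s) ℕ.* 2 ℕ.^ D ℕ.≤ n ℕ.+ D ℕ.* 2 ℕ.^ D) total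
             (Layout-capacity In left right (layout s)) ,
           ≤-trans (≤-reflexive (cong (λ cs → variation (catMaybes cs)) final)) (cells-variation s)
        where
        start : toList (initial k) ≡ cells (after [])
        start = cong (just 0# ∷_) (trans (Vecₚ.toList-∷ʳ (just 1#) (Vec.replicate k nothing))
          (cong (_++ just 1# ∷ []) (Vecₚ.toList-replicate k nothing)))

-- Choice of the depth and the resulting estimates

last-true : ∀ {P : ℕ → Set} → (∀ i → Dec (P i)) → ∀ n → P 0 → ¬ P n → ∃[ i ] P i × ¬ P (suc i)
last-true P? zero    p ¬q = contradiction p ¬q
last-true P? (suc n) p ¬q with P? n
-- The search goes down from a failing index, so the first success is followed by a failure.
... | yes q = n , q , ¬q
... | no ¬r = last-true P? n p ¬r

-- If `m` exceeds `e`, it is at least 1, so `2 ^ m ≤ 2 ^ e * n` and `2 ^ e` cancels. Otherwise the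
-- exponent is 0.
2^[m∸e]≤n : ∀ m e n → 1 ℕ.≤ n → m ℕ.* 2 ℕ.^ m ℕ.≤ 2 ℕ.^ e ℕ.* n → 2 ℕ.^ (m ℕ.∸ e) ℕ.≤ n
2^[m∸e]≤n m e n 1≤n le with ℕₚ.≤-<-connex m e
... | inj₁ m≤e = subst (λ j → 2 ℕ.^ j ℕ.≤ n) (sym (ℕₚ.m≤n⇒m∸n≡0 m≤e)) 1≤n
... | inj₂ e<m@(s≤s _) = ℕₚ.*-cancelˡ-≤ (2 ℕ.^ e) {{ℕₚ.m^n≢0 2 e}} (begin
  2 ℕ.^ e ℕ.* 2 ℕ.^ (m ℕ.∸ e) ≡⟨ ℕₚ.^-distribˡ-+-* 2 e (m ℕ.∸ e) ⟨
  2 ℕ.^ (e ℕ.+ (m ℕ.∸ e))     ≡⟨ cong (2 ℕ.^_) (ℕₚ.m+[n∸m]≡n (ℕₚ.<⇒≤ e<m)) ⟩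
  2 ℕ.^ m                     ≤⟨ ℕₚ.m≤m+n (2 ℕ.^ m) _ ⟩
  m ℕ.* 2 ℕ.^ m               ≤⟨ le ⟩
  2 ℕ.^ e ℕ.* n               ∎)
  where open ℕₚ.≤-Reasoning

n≤2^n : ∀ n → n ℕ.≤ 2 ℕ.^ n
n≤2^n zero    = z≤n
n≤2^n (suc n) = ℕₚ.+-mono-≤ (ℕₚ.m^n>0 2 n) (ℕₚ.≤-trans (n≤2^n n) (ℕₚ.m≤m+n (2 ℕ.^ n) 0))

module CostEstimate (R : Reals) where
  open Reals R
  open OrderedFieldProperties orderedField
  open CommutativeRing commutativeRing using (*-identityˡ; *-identityʳ; *-assoc; distribʳ)
  open Log₂ R using (log₂)
  open Logarithm R

  2# : ℝ
  2# = 1# + 1#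

  0<2# : 0# < 2#
  0<2# = 1≤⇒0< (x≤x+y 0≤1)

  -- The constant `K`: the first factor arises in `cost-estimate`, and the second is the square of
  -- the ratio of depth to logarithm in `depth≤log₂`.
  factor : ℝ → ℕ → ℝ
  factor C e = ((1# + C) * 2# + C * 2#) * (fromℕ (2 ℕ.+ e) * fromℕ (2 ℕ.+ e))

  0<factor : ∀ {C} e → 0# < C → 0# < factor C e
  0<factor {C} e (0≤C , _) = 0<*
    (<-≤-trans (0<* (1≤⇒0< (x≤x+y 0≤C)) 0<2#) (x≤x+y (*-nonNegative 0≤C (proj₁ 0<2#))))
    (0<* 0<e 0<e)
    where
    0<e : 0# < fromℕ (2 ℕ.+ e)
    0<e = 1≤⇒0< (1≤fromℕ-suc (suc e))

  -- Here `M` is the number of root boxes, `s` is `2 ^ D`, `N` is `n`, `d` is `D + 1`, `L` is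
  -- `log₂ n` and `x` is the cost. The cost is multiplied by `ε` because the choice of depth
  -- controls `ε * N`.
  cost-estimate : ∀ {C ε M N s d g L x} → 0# < ε → ε ≤ C → 0# < s → 0# ≤ M → 0# ≤ N → 1# ≤ d →
    M * s ≤ (1# + ε) * N → ε * N ≤ d * (s + s) → d ≤ g * L → x ≤ (M + 2#) * d →
    x ≤ ((1# + C) * 2# + C * 2#) * (g * g) * (L * L / ε)
  cost-estimate {C} {ε} {M} {N} {s} {d} {g} {L} {x} 0<ε ε≤C 0<s 0≤M 0≤N 1≤d Ms≤ εN≤ d≤ x≤ =
    subst (x ≤_) (*-assoc K (L * L) (ε ⁻¹)) (*≤⇒≤/ 0<ε (begin
      x * ε
        ≤⟨ *-monoˡ-≤ 0≤ε x≤ ⟩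
      (M + 2#) * d * ε
        ≡⟨ solve 4 (λ M t d ε → (M :+ t) :* d :* ε := (ε :* M :+ ε :* t) :* d) refl M 2# d ε ⟩
      (ε * M + ε * 2#) * d
        -- The sentinel jumps contribute `ε * 2#`, at most `C * 2#`, and `1# ≤ d` supplies the
        -- common factor `d`.
        ≤⟨ *-monoˡ-≤ 0≤d (+-mono-≤ εM≤ (≤-trans (*-monoˡ-≤ 0≤2 ε≤C)
             (subst (_≤ C * 2# * d) (*-identityʳ _) (*-monoʳ-≤ (*-nonNegative 0≤C 0≤2) 1≤d)))) ⟩
      ((1# + C) * 2# * d + C * 2# * d) * d
        ≡⟨ solve 3 (λ a b d → (a :* d :+ b :* d) :* d := (a :+ b) :* (d :* d)) refl ((1# + C) * 2#) (C * 2#) d ⟩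
      ((1# + C) * 2# + C * 2#) * (d * d)
        ≤⟨ *-monoʳ-≤ (≤-trans (*-nonNegative 0≤1+C 0≤2) (x≤x+y (*-nonNegative 0≤C 0≤2)))
             (*-mono-≤ (≤-trans 0≤d d≤) 0≤d d≤ d≤) ⟩
      ((1# + C) * 2# + C * 2#) * (g * L * (g * L))
        ≡⟨ solve 3 (λ a g L → a :* (g :* L :* (g :* L)) := a :* (g :* g) :* (L :* L)) refl _ g L ⟩
      K * (L * L) ∎))
    where
    open ≤-Reasoning
    open Solver
    K = ((1# + C) * 2# + C * 2#) * (g * g)
    0≤ε = proj₁ 0<ε
    0≤C = ≤-trans 0≤ε ε≤C
    0≤1+C = ≤-trans 0≤1 (x≤x+y 0≤C)
    0≤2 = proj₁ 0<2#
    0≤d = ≤-trans 0≤1 1≤d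
    -- Maximality of the depth replaces `ε * N` by `d * (s + s)`, and then the box size `s` cancels.
    εM≤ : ε * M ≤ (1# + C) * 2# * d
    εM≤ = *-cancelʳ-≤ 0<s (begin
      ε * M * s
        ≡⟨ *-assoc ε M s ⟩
      ε * (M * s)
        ≤⟨ *-monoʳ-≤ 0≤ε Ms≤ ⟩
      ε * ((1# + ε) * N)
        ≡⟨ solve 3 (λ ε a N → ε :* (a :* N) := a :* (ε :* N)) refl ε (1# + ε) N ⟩
      (1# + ε) * (ε * N)
        ≤⟨ *-mono-≤ 0≤1+C (*-nonNegative 0≤ε 0≤N) (+-monoʳ-≤ 1# ε≤C) εN≤ ⟩
      (1# + C) * (d * (s + s))
        ≡⟨ cong (λ t → (1# + C) * (d * t))
             (sym (trans (distribʳ s 1# 1#) (cong₂ _+_ (*-identityˡ s) (*-identityˡ s)))) ⟩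
      (1# + C) * (d * (2# * s))
        ≡⟨ solve 4 (λ a d t s → a :* (d :* (t :* s)) := a :* t :* d :* s) refl (1# + C) d 2# s ⟩
      (1# + C) * 2# * d * s ∎)

  -- Since `C ≤ 2 ^ e`, the depth beyond `e` satisfies `2 ^ (D ∸ e) ≤ n` and is at most the
  -- logarithm. The remaining `suc e` is absorbed because `1# ≤ log₂ n`.
  depth≤log₂ : ∀ {C ε} D e n → 2 ℕ.≤ n → ε ≤ C → C ≤ fromℕ e → fromℕ (D ℕ.* 2 ℕ.^ D) ≤ ε * fromℕ n →
               fromℕ (suc D) ≤ fromℕ (2 ℕ.+ e) * log₂ n
  depth≤log₂ {C} {ε} D e n 2≤n ε≤C C≤e D≤ = begin
    fromℕ (suc D)
      ≤⟨ fromℕ-mono (ℕₚ.≤-trans (s≤s (ℕₚ.m≤n+m∸n D e)) (ℕₚ.≤-reflexive (ℕₚ.+-comm (suc e) (D ℕ.∸ e)))) ⟩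
    fromℕ (D ℕ.∸ e ℕ.+ suc e)
      ≡⟨ fromℕ-+ (D ℕ.∸ e) (suc e) ⟩
    fromℕ (D ℕ.∸ e) + fromℕ (suc e)
      ≤⟨ +-mono-≤ (fromℕ≤log₂ (D ℕ.∸ e) 1≤n (2^[m∸e]≤n D e n 1≤n (fromℕ-cancel-≤ bound)))
           (subst (_≤ fromℕ (suc e) * L) (*-identityʳ _) (*-monoʳ-≤ (0≤fromℕ (suc e)) (1≤log₂ 2≤n))) ⟩
    L + fromℕ (suc e) * L
      ≡⟨ cong (_+ fromℕ (suc e) * L) (*-identityˡ L) ⟨
    1# * L + fromℕ (suc e) * L
      ≡⟨ distribʳ L 1# (fromℕ (suc e)) ⟨
    fromℕ (2 ℕ.+ e) * L ∎
    where
    open ≤-Reasoning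
    L = log₂ n
    1≤n = ℕₚ.≤-trans (s≤s z≤n) 2≤n
    bound : fromℕ (D ℕ.* 2 ℕ.^ D) ≤ fromℕ (2 ℕ.^ e ℕ.* n)
    bound = begin
      fromℕ (D ℕ.* 2 ℕ.^ D)       ≤⟨ D≤ ⟩
      ε * fromℕ n                 ≤⟨ *-monoˡ-≤ (0≤fromℕ n) (≤-trans ε≤C (≤-trans C≤e (fromℕ-mono (n≤2^n e)))) ⟩
      fromℕ (2 ℕ.^ e) * fromℕ n   ≡⟨ fromℕ-* (2 ℕ.^ e) n ⟨
      fromℕ (2 ℕ.^ e ℕ.* n)       ∎

  -- Used with `y` equal to `ε * n`, the number of spare cells: the first bound makes the waste fit,
  -- the second keeps the boxes large enough for the cost.
  deepest : ∀ y → 0# ≤ y → ∃[ D ] fromℕ (D ℕ.* 2 ℕ.^ D) ≤ y × y ≤ fromℕ (suc D) * (fromℕ (2 ℕ.^ D) + fromℕ (2 ℕ.^ D))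
  deepest y 0≤y =
    let N , y≤N = archimedean y
        D , p , ¬q = last-true (λ i → fromℕ (i ℕ.* 2 ℕ.^ i) ≤? y) (suc N) 0≤y
          -- The search starts at `suc N` with `y ≤ N`, where the factor `suc N` alone exceeds `y`.
          (λ q → 1+x≰x (≤-trans (fromℕ-mono (ℕₚ.m≤m*n (suc N) (2 ℕ.^ suc N) {{ℕₚ.m^n≢0 2 (suc N)}})) (≤-trans q y≤N)))
    in D , p , subst (y ≤_) (trans (fromℕ-* (suc D) (2 ℕ.^ suc D)) (cong (fromℕ (suc D) *_) (fromℕ-2^suc D))) (≰⇒≥ ¬q)

-- Choice of the constants and of the array size

mainTheorem1 : (R : Reals) → let open Reals R in let open OnlineSorting R in
    ∃[ c ] 0# < c ×
    ((C : ℝ) → 0# < C →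
    ∃[ K ] 0# < K ×
    ((n : ℕ) → 2 ℕ.≤ n →
    (ε : ℝ) → c * (log₂ n / fromℕ n) ≤ ε → ε ≤ C →
    ∃[ k ] (n ℕ.≤ 2 ℕ.+ k) × (fromℕ (2 ℕ.+ k) ≤ (1# + ε) * fromℕ n) ×
    (Σ[ A ∈ OnlineAlgorithm (2 ℕ.+ k) ]
    ((xs : List ℝ) → 2 ℕ.+ length xs ≡ n → All InUnitInterval xs →
    ∃[ a ] (run A [] xs (initial k) ≡ just a) ×
    (cost a ≤ K * (log₂ n * log₂ n / ε))))))
mainTheorem1 R = 1# , 1≤⇒0< ≤-refl , λ C 0<C →
  -- `e` depends on `C` alone, so the constant is fixed before `n` and `ε` are given.
  let e , C≤e = archimedean C
  in factor C e , 0<factor e 0<C , λ n 2≤n ε c≤ε ε≤C → solution C e C≤e n 2≤n ε c≤ε ε≤C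
  where
  open Reals R
  open OnlineSorting R
  open OrderedFieldProperties orderedField
  open CommutativeRing commutativeRing using (*-identityˡ; distribʳ)
  open Logarithm R
  open DyadicSorting R
  open CostEstimate R

  solution : ∀ C e → C ≤ fromℕ e → ∀ n → 2 ℕ.≤ n → ∀ ε → 1# * (log₂ n / fromℕ n) ≤ ε → ε ≤ C →
    ∃[ k ] (n ℕ.≤ 2 ℕ.+ k) × (fromℕ (2 ℕ.+ k) ≤ (1# + ε) * fromℕ n) ×
    (Σ[ A ∈ OnlineAlgorithm (2 ℕ.+ k) ]
    ((xs : List ℝ) → 2 ℕ.+ length xs ≡ n → All InUnitInterval xs →
    ∃[ a ] (run A [] xs (initial k) ≡ just a) ×
    (cost a ≤ factor C e * (log₂ n * log₂ n / ε))))
  solution C e C≤e n@(suc (suc n′)) 2≤n@(s≤s (s≤s _)) ε c≤ε ε≤C =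
    k , s≤s (s≤s (ℕₚ.m≤m+n n′ _)) , space , sorter D k , λ { xs refl ps →
      let a , run≡ , m , m≤ , cost≤ = sorter-sound D k xs ps ℕₚ.≤-refl
      in a , run≡ , cost-estimate 0<ε ε≤C (0<2^ D) (0≤fromℕ m) (0≤fromℕ n) (1≤fromℕ-suc D)
           (subst (_≤ (1# + ε) * fromℕ n) (fromℕ-* m (2 ℕ.^ D))
             (≤-trans (fromℕ-mono (ℕₚ.≤-trans m≤ (ℕₚ.m≤n+m k 2))) space))
           D-maximal (depth≤log₂ D e n 2≤n ε≤C C≤e D-fits) cost≤ }
    where
    -- With `c` equal to 1, the lower bound on `ε` makes it positive, as `1# ≤ log₂ n`.
    0<ε : 0# < ε
    0<ε = <-≤-trans (0<* (1≤⇒0< ≤-refl) (0<* (1≤⇒0< (1≤log₂ 2≤n)) (0<⇒0<⁻¹ (1≤⇒0< (1≤fromℕ-suc (suc n′)))))) c≤ε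
    depth = deepest (ε * fromℕ n) (*-nonNegative (proj₁ 0<ε) (0≤fromℕ n))
    D = proj₁ depth
    D-fits = proj₁ (proj₂ depth)
    D-maximal = proj₂ (proj₂ depth)
    -- The sentinels are two of the `n` elements, so the interior holds the other `n′` and the
    -- waste, bounded by `D * 2 ^ D`.
    k = n′ ℕ.+ D ℕ.* 2 ℕ.^ D
    space : fromℕ (2 ℕ.+ k) ≤ (1# + ε) * fromℕ n
    space = ≤-trans (≤-reflexive (fromℕ-+ n (D ℕ.* 2 ℕ.^ D))) (≤-trans (+-monoʳ-≤ (fromℕ n) D-fits)
      (≤-reflexive (sym (trans (distribʳ (fromℕ n) 1# ε) (cong (_+ ε * fromℕ n) (*-identityˡ (fromℕ n)))))))
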